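{- There is an absolute constant $c$ such that every graph $G$ with $n \ge 2$ vertices and sim-width $k \ge 1$ has neighbor-depth at most $c\, k \log^2 n$ (i.e., any $n$-vertex graph of sim-width $k$ has neighbor-depth $O(k\log^2 n)$).
   Context: For a graph $G$ and $A \subseteq V(G)$, $\overline{A} = V(G)\setminus A$. $\mathrm{sw}(A)$ is the maximum size of an induced matching $M$ in $G$ (a matching such that the subgraph of $G$ induced by its endpoints has no edges other than $M$) each of whose edges has one endpoint in $A$ and the other in $\overline{A}$. A branch decomposition of $V(G)$ is a pair $(T,\delta)$ with $T$ a tree whose internal nodes have degree $3$ and $\delta$ a bijection from $V(G)$ to the leaves of $T$; each edge $e$ of $T$ yields a bipartition $(A_e,\overline{A_e})$ of $V(G)$ according to the leaves on each side, with width $\mathrm{sw}(A_e)$. The sim-width of $G$ is the minimum over branch decompositions of the maximum edge width. The neighbor-depth $\mathrm{nd}(G)$ is defined recursively: $\mathrm{nd}(G)=0$ iff $V(G)=\emptyset$; if $G$ is disconnected, $\mathrm{nd}(G)$ is the maximum of $\mathrm{nd}$ over its connected components; if $G$ is non-empty and connected, $\mathrm{nd}(G)\le k$ iff there is $v\in V(G)$ with $\mathrm{nd}(G\setminus N[v])\le k-1$ and $\mathrm{nd}(G\setminus\{v\})\le k$, where $N[v]$ is the closed neighborhood of $v$. -}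

module Defs where

open import Data.Nat using (ℕ; zero; suc; _≤_)
open import Data.Fin using (Fin)
open import Data.Bool using (Bool; true; false)
open import Data.Product using (Σ; _×_; _,_; ∃-syntax)
open import Data.List using (List; []; _∷_; _++_)
open import Data.List.Membership.Propositional using (_∈_)
open import Data.List.Relation.Unary.Unique.Propositional using (Unique)
open import Relation.Binary.PropositionalEquality using (_≡_; _≢_)
open import Relation.Nullary using (¬_)
open import Data.Unit using (⊤)

record Graph (n : ℕ) : Set where
  field
    adj     : Fin n → Fin n → Bool
    adj-sym : ∀ u v → adj u v ≡ adj v u
    adj-irr : ∀ v → adj v v ≡ false

open Graph public

module _ {n : ℕ} (G : Graph n) where

  Adj : Fin n → Fin n → Set
  Adj u v = adj G u v ≡ true

  VSet : Set₁
  VSet = Fin n → Set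

  record InducedMatchingAcross (A : VSet) (m : ℕ) : Set where
    field
      a b      : Fin m → Fin n
      a∈A      : ∀ i → A (a i)
      b∉A      : ∀ i → ¬ A (b i)
      edge     : ∀ i → Adj (a i) (b i)
      a-inj    : ∀ i j → a i ≡ a j → i ≡ j
      b-inj    : ∀ i j → b i ≡ b j → i ≡ j
      no-aa    : ∀ i j → i ≢ j → ¬ Adj (a i) (a j)
      no-ab    : ∀ i j → i ≢ j → ¬ Adj (a i) (b j)
      no-bb    : ∀ i j → i ≢ j → ¬ Adj (b i) (b j)

  SwLE : VSet → ℕ → Set
  SwLE A k = ∀ m → InducedMatchingAcross A m → m ≤ k

  -- Branch decompositions.  A cubic tree T with leaves bijectively
  -- labelled by V(G) (n ≥ 2) is represented by rooting it at (a
  -- subdivision of) one of its edges: a full binary tree whose leaves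
  -- are labelled bijectively by V(G).  The edges of T correspond to the
  -- proper subtrees; the cut of such an edge is (leaves of subtree, rest).

  data BTree : Set where
    leaf : Fin n → BTree
    node : BTree → BTree → BTree

  leaves : BTree → List (Fin n)
  leaves (leaf v)   = v ∷ []
  leaves (node l r) = leaves l ++ leaves r

  data Subtree : BTree → BTree → Set where
    here  : ∀ {t} → Subtree t t
    left  : ∀ {s l r} → Subtree s l → Subtree s (node l r)
    right : ∀ {s l r} → Subtree s r → Subtree s (node l r)

  IsBranchDecomposition : BTree → Set
  IsBranchDecomposition T = Unique (leaves T) × (∀ v → v ∈ leaves T)

  -- Every edge of T has width ≤ k (the root "cut" (V, ∅) has width 0).
  WidthLE : BTree → ℕ → Set
  WidthLE T k = ∀ s → Subtree s T → SwLE (λ v → v ∈ leaves s) k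

  SimWidthLE : ℕ → Set
  SimWidthLE k = ∃[ T ] (IsBranchDecomposition T × WidthLE T k)

  SimWidth : ℕ → Set
  SimWidth k = SimWidthLE k × (∀ j → SimWidthLE j → k ≤ j)

  -- Neighbor-depth of induced subgraphs G[S]: ND k S means nd(G[S]) ≤ k.

  data Reach (S : VSet) : Fin n → Fin n → Set where
    stay : ∀ {u} → S u → Reach S u u
    step : ∀ {u w x} → S u → Adj u w → Reach S w x → Reach S u x

  Connected : VSet → Set
  Connected S = ∀ u w → S u → S w → Reach S u w

  Component : VSet → Fin n → VSet
  Component S u w = Reach S u w

  MinusN : VSet → Fin n → VSet
  MinusN S v w = S w × w ≢ v × ¬ Adj v w

  Minus : VSet → Fin n → VSet
  Minus S v w = S w × w ≢ v

  data ND : ℕ → VSet → Set₁ where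
    -- empty graph: nd = 0 (hence ≤ k for all k)
    empty : ∀ {k S} → (∀ v → ¬ S v) → ND k S
    -- disconnected: nd is the max over the components
    disconnected : ∀ {k S} → ¬ Connected S →
                   (∀ u → S u → ND k (Component S u)) → ND k S
    connected : ∀ {k S} v → Connected S → S v →
                ND k (MinusN S v) → ND (suc k) (Minus S v) → ND (suc k) S

  NeighborDepthLE : ℕ → Set₁
  NeighborDepthLE k = ND k (λ _ → ⊤)

{-# OPTIONS --safe #-}
module Submission where

-- If a cut has sim-width at most k, a greedily built induced matching across
-- it stops after k edges, so the closed neighborhoods of its at most 2k
-- endpoints touch every cut edge, and one of them touches a 1/(2k) fraction.
-- Branching on such vertices, each removal of a closed neighborhood scales
-- the number of cut edges (at most n²) by a factor of at most 1 − 1/(2k+1),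
-- so O(k log n) removals eliminate them, while deleting the vertex alone
-- only makes the graph smaller.  Some cut of the branch decomposition splits
-- the current vertex set into parts of at most 2/3 of its size, so O(log n)
-- rounds of this suffice.

open import Defs
open import Data.Nat using (ℕ; _*_; _≤_)
open import Data.Nat.Logarithm using (⌈log₂_⌉)
open import Data.Product using (∃-syntax)

open import Data.Bool using (true)
open import Data.Bool.Properties using () renaming (_≟_ to _≟ᵇ_)
open import Data.Fin using (Fin; zero; suc)
open import Data.Fin.Properties using (_≟_; any?; all?)
open import Data.List using (List; []; _∷_; length; map; filter; allFin; cartesianProduct)
open import Data.List.Membership.Propositional using (_∈_; lose)
open import Data.List.Membership.Propositional.Properties
  using (∈-allFin; ∈-cartesianProduct⁺; ∈-++⁻; ∈-filter⁻)
open import Data.List.Properties using (filter-some; length-filter; length-map; length-++; length-tabulate)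
open import Data.List.Relation.Unary.All using ([]; _∷_)
open import Data.List.Relation.Unary.Any using (here; there)
open import Data.List.Relation.Unary.AllPairs using ([]; _∷_)
open import Data.List.Relation.Unary.Unique.Propositional using (Unique)
open import Data.List.Relation.Unary.Unique.Propositional.Properties using (filter⁺; allFin⁺)
open import Data.Nat
  using (zero; suc; pred; _+_; _^_; _<_; _≤?_; z≤n; s≤s; NonZero; ⌊_/2⌋; ⌈_/2⌉; >-nonZero)
open import Data.Nat.DivMod using (_/_; _%_; m≡m%n+[m/n]*n; m%n<n; m/n*n≤m)
open import Data.Nat.Logarithm using (⌈log₂⌉-mono-≤; ⌈log₂⌈n/2⌉⌉≡⌈log₂n⌉∸1)
open import Data.Nat.Properties hiding (_≟_)
open import Data.Nat.Tactic.RingSolver using (solve-∀)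
open import Data.Product using (Σ; ∃; _×_; _,_; proj₁; proj₂)
open import Data.Sum using (_⊎_; inj₁; inj₂; [_,_])
open import Data.Unit using (⊤; tt)
open import Data.Vec.Functional using () renaming (_∷_ to _∷ᶠ_; [] to []ᶠ)
open import Function using (_∘_; id)
open import Relation.Binary.PropositionalEquality using (_≡_; _≢_; refl; sym; trans; cong; cong₂; subst)
open import Relation.Nullary using (¬_; Dec; yes; no; contradiction)
open import Relation.Nullary.Decidable using (map′; _×-dec_; _⊎-dec_; _→-dec_; ¬?)
open import Relation.Unary using (Decidable)
import Data.List.Membership.DecPropositional as DecMembership

open ≤-Reasoning

-- Counting

count : {X : Set} {P : X → Set} → Decidable P → List X → ℕ
count P? xs = length (filter P? xs)

module _ {X : Set} {P Q R : X → Set}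
         (P? : Decidable P) (Q? : Decidable Q) (R? : Decidable R) where

  count-cover : (∀ {x} → R x → P x ⊎ Q x) →
                ∀ xs → count R? xs ≤ count P? xs + count Q? xs
  count-cover R⊆P∪Q [] = z≤n
  count-cover R⊆P∪Q (x ∷ xs)
    with ih ← count-cover R⊆P∪Q xs | R? x | P? x | Q? x
  ... | yes r | yes p | yes q = s≤s (≤-trans ih (+-monoʳ-≤ _ (n≤1+n _)))
  ... | yes r | yes p | no ¬q = s≤s ih
  ... | yes r | no ¬p | yes q = ≤-trans (s≤s ih) (≤-reflexive (sym (+-suc _ _)))
  ... | yes r | no ¬p | no ¬q = contradiction (R⊆P∪Q r) [ ¬p , ¬q ]
  ... | no ¬r | yes p | yes q = ≤-trans ih (+-mono-≤ (n≤1+n _) (n≤1+n _))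
  ... | no ¬r | yes p | no ¬q = m≤n⇒m≤1+n ih
  ... | no ¬r | no ¬p | yes q = ≤-trans ih (+-monoʳ-≤ _ (n≤1+n _))
  ... | no ¬r | no ¬p | no ¬q = ih

  count-disjoint : (∀ {x} → P x → R x) → (∀ {x} → Q x → R x) →
                   (∀ {x} → P x → ¬ Q x) →
                   ∀ xs → count P? xs + count Q? xs ≤ count R? xs
  count-disjoint P⊆R Q⊆R P∩Q=∅ [] = z≤n
  count-disjoint P⊆R Q⊆R P∩Q=∅ (x ∷ xs)
    with ih ← count-disjoint P⊆R Q⊆R P∩Q=∅ xs | R? x | P? x | Q? x
  ... | yes r | yes p | yes q = contradiction q (P∩Q=∅ p)
  ... | yes r | yes p | no ¬q = s≤s ih
  ... | yes r | no ¬p | yes q = ≤-trans (≤-reflexive (+-suc _ _)) (s≤s ih)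
  ... | yes r | no ¬p | no ¬q = m≤n⇒m≤1+n ih
  ... | no ¬r | yes p | _     = contradiction (P⊆R p) ¬r
  ... | no ¬r | no ¬p | yes q = contradiction (Q⊆R q) ¬r
  ... | no ¬r | no ¬p | no ¬q = ih

count-mono : {X : Set} {P R : X → Set} (P? : Decidable P) (R? : Decidable R) →
             (∀ {x} → P x → R x) → ∀ xs → count P? xs ≤ count R? xs
count-mono P? R? P⊆R xs = m+n≤o⇒m≤o _
  (count-disjoint P? (λ _ → no id) R? P⊆R (λ ()) (λ _ ()) xs)

count-witness : {X : Set} {P : X → Set} (P? : Decidable P) →
                ∀ xs → 0 < count P? xs → ∃ P
count-witness P? (x ∷ xs) 0<c with P? x
... | yes p = x , p
... | no ¬p = count-witness P? xs 0<c

count-none : {X : Set} {P : X → Set} (P? : Decidable P) →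
             ∀ {x xs} → x ∈ xs → count P? xs ≤ 0 → ¬ P x
count-none P? x∈xs c≤0 p = <⇒≱ (filter-some P? (lose x∈xs p)) c≤0

length-cartesianProduct : {X Y : Set} (xs : List X) (ys : List Y) →
                          length (cartesianProduct xs ys) ≡ length xs * length ys
length-cartesianProduct []       ys = refl
length-cartesianProduct (x ∷ xs) ys = trans
  (length-++ (map (x ,_) ys))
  (cong₂ _+_ (length-map (x ,_) ys) (length-cartesianProduct xs ys))

-- Arithmetic

-- Induction on a bound `l` for the logarithm: the half of `m`, rounded up, has a logarithm smaller
-- by one, and `m` is the sum of its two halves.
n≤2^⌈log₂n⌉ : ∀ n → n ≤ 2 ^ ⌈log₂ n ⌉
n≤2^⌈log₂n⌉ n = go ⌈log₂ n ⌉ n ≤-refl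
  where
  go : ∀ l m → ⌈log₂ m ⌉ ≤ l → m ≤ 2 ^ l
  go zero    m log≤0 = ≮⇒≥ λ 1<m → <⇒≱ (⌈log₂⌉-mono-≤ 1<m) log≤0
  go (suc l) m log≤1+l = begin
    m                         ≡⟨ ⌊n/2⌋+⌈n/2⌉≡n m ⟨
    ⌊ m /2⌋ + ⌈ m /2⌉         ≤⟨ +-mono-≤ (≤-trans (⌊n/2⌋≤⌈n/2⌉ m) ih) ih ⟩
    2 ^ l + 2 ^ l             ≡⟨ cong (2 ^ l +_) (+-identityʳ _) ⟨
    2 ^ suc l                 ∎
    where
    ih : ⌈ m /2⌉ ≤ 2 ^ l
    ih = go l ⌈ m /2⌉ (≤-trans (≤-reflexive (⌈log₂⌈n/2⌉⌉≡⌈log₂n⌉∸1 m)) (∸-monoˡ-≤ 1 log≤1+l))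

-- Bernoulli's inequality `(1 + 1/r)^j ≥ 1 + j/r`, multiplied by `r^(j+1)` to clear denominators.
bernoulli : ∀ r j → (r + j) * r ^ j ≤ r * suc r ^ j
bernoulli r zero    = ≤-reflexive (trans (*-identityʳ _) (trans (+-identityʳ r) (sym (*-identityʳ r))))
bernoulli r (suc j) = begin
  (r + suc j) * (r * r ^ j)                ≤⟨ m≤m+n _ (j * r ^ j) ⟩
  (r + suc j) * (r * r ^ j) + j * r ^ j    ≡⟨ eq₁ r j (r ^ j) ⟩
  (r + j) * r ^ j * suc r                  ≤⟨ *-monoˡ-≤ (suc r) (bernoulli r j) ⟩
  r * suc r ^ j * suc r                    ≡⟨ eq₂ r (suc r ^ j) ⟩
  r * (suc r * suc r ^ j)                  ∎
  where
  eq₁ : ∀ r j x → (r + suc j) * (r * x) + j * x ≡ (r + j) * x * suc r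
  eq₁ = solve-∀
  eq₂ : ∀ r x → r * x * suc r ≡ r * (suc r * x)
  eq₂ = solve-∀

-- The case `j = r` of Bernoulli: scaling `r` times by `r / (1 + r)` at least halves a number.
2r^r≤[1+r]^r : ∀ r .{{_ : NonZero r}} → 2 * r ^ r ≤ suc r ^ r
2r^r≤[1+r]^r r = *-cancelˡ-≤ r (≤-trans (≤-reflexive (eq r (r ^ r))) (bernoulli r r))
  where
  eq : ∀ r x → r * (2 * x) ≡ (r + r) * x
  eq = solve-∀

2^j*r^[r*j]≤[1+r]^[r*j] : ∀ r .{{_ : NonZero r}} j → 2 ^ j * r ^ (r * j) ≤ suc r ^ (r * j)
2^j*r^[r*j]≤[1+r]^[r*j] r j = begin
  2 ^ j * r ^ (r * j)      ≡⟨ cong (2 ^ j *_) (^-*-assoc r r j) ⟨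
  2 ^ j * (r ^ r) ^ j      ≡⟨ ^-distribʳ-* j ⟨
  (2 * r ^ r) ^ j          ≤⟨ ^-monoˡ-≤ j (2r^r≤[1+r]^r r) ⟩
  (suc r ^ r) ^ j          ≡⟨ ^-*-assoc (suc r) r j ⟩
  suc r ^ (r * j)          ∎
  where
  eq : ∀ x y z w → x * y * (z * w) ≡ x * z * (y * w)
  eq = solve-∀
  ^-distribʳ-* : ∀ j {x y} → (x * y) ^ j ≡ x ^ j * y ^ j
  ^-distribʳ-* zero            = refl
  ^-distribʳ-* (suc j) {x} {y} =
    trans (cong (x * y *_) (^-distribʳ-* j)) (eq x y (x ^ j) (y ^ j))

-- Since `2 * (2/3)^2 = 8/9 < 1`, two rounds of shrinking to 2/3 pay for each factor 2 in `2 ^ l`;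
-- hence `2 * l` rounds bring `n` down to at most 1.
n*4^l≤9^l : ∀ {n} l → n ≤ 2 ^ l → n * 2 ^ (2 * l) ≤ 3 ^ (2 * l)
n*4^l≤9^l {n} l n≤2^l = begin
  n * 2 ^ (2 * l)       ≤⟨ *-monoˡ-≤ (2 ^ (2 * l)) n≤2^l ⟩
  2 ^ l * 2 ^ (2 * l)   ≡⟨ ^-distribˡ-+-* 2 l (2 * l) ⟨
  2 ^ (3 * l)           ≡⟨ ^-*-assoc 2 3 l ⟨
  8 ^ l                 ≤⟨ ^-monoˡ-≤ l (n≤1+n 8) ⟩
  9 ^ l                 ≡⟨ ^-*-assoc 3 2 l ⟩
  3 ^ (2 * l)           ∎

-- Vertex sets and their sizes

module _ {n : ℕ} (G : Graph n) where

  adj? : ∀ u w → Dec (Adj G u w)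
  adj? u w = adj G u w ≟ᵇ true

  Adj-sym : ∀ {u w} → Adj G u w → Adj G w u
  Adj-sym {u} {w} = trans (adj-sym G w u)

  size : {S : VSet G} → Decidable S → ℕ
  size S? = count S? (allFin n)

  minus? : {S : VSet G} → Decidable S → ∀ v → Decidable (Minus G S v)
  minus? S? v w = S? w ×-dec ¬? (w ≟ v)

  minusN? : {S : VSet G} → Decidable S → ∀ v → Decidable (MinusN G S v)
  minusN? S? v w = S? w ×-dec (¬? (w ≟ v) ×-dec ¬? (adj? v w))

  size-nonempty : {S : VSet G} (S? : Decidable S) → ∀ {v} → S v → 0 < size S?
  size-nonempty S? {v} sv = filter-some S? (lose (∈-allFin v) sv)

  size-minus : {S : VSet G} (S? : Decidable S) → ∀ {v} → S v → size (minus? S? v) < size S?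
  size-minus S? {v} sv = begin-strict
    size (minus? S? v)                  <⟨ m<n+m _ (size-nonempty (_≟ v) refl) ⟩
    size (_≟ v) + size (minus? S? v)    ≤⟨ count-disjoint (_≟ v) (minus? S? v) S? (λ { refl → sv }) proj₁
                                             (λ { refl (_ , v≢v) → v≢v refl }) (allFin n) ⟩
    size S?                             ∎

  -- Connectivity

  module _ {S : VSet G} where

    reach-start : ∀ {u w} → Reach G S u w → S u
    reach-start (stay su)     = su
    reach-start (step su _ _) = su

    reach-end : ∀ {u w} → Reach G S u w → S w
    reach-end (stay su)    = su
    reach-end (step _ _ r) = reach-end r

    reach-trans : ∀ {u w x} → Reach G S u w → Reach G S w x → Reach G S u x
    reach-trans (stay _)      r′ = r′
    reach-trans (step su e r) r′ = step su e (reach-trans r r′)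

    reach-sym : ∀ {u w} → Reach G S u w → Reach G S w u
    reach-sym (stay su)     = stay su
    reach-sym (step su e r) =
      reach-trans (reach-sym r) (step (reach-start r) (Adj-sym e) (stay su))

    reach-in-component : ∀ {t u w} → Reach G S t u → Reach G S u w →
                         Reach G (Component G S t) u w
    reach-in-component p (stay su)     = stay p
    reach-in-component p (step su e r) =
      step p e (reach-in-component (reach-trans p (step su e (stay (reach-start r)))) r)

    component-connected : ∀ t → Connected G (Component G S t)
    component-connected t u w p q = reach-in-component p (reach-trans (reach-sym p) q)

    -- Cutting a walk at its last visit to u.
    reach-avoiding : ∀ u {w x} → Reach G S w x → x ≢ u →
                     Reach G (Minus G S u) w x ⊎
                     (∃[ t ] (Adj G u t × Reach G (Minus G S u) t x))
    reach-avoiding u (stay sw) x≢u = inj₁ (stay (sw , x≢u))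
    reach-avoiding u {w} (step sw e r) x≢u with reach-avoiding u r x≢u | w ≟ u
    ... | inj₂ r′ | _        = inj₂ r′
    ... | inj₁ r′ | yes refl = inj₂ (_ , e , r′)
    ... | inj₁ r′ | no w≢u   = inj₁ (step (sw , w≢u) e r′)

  reach-mono : ∀ {S S′ : VSet G} → (∀ {v} → S v → S′ v) →
               ∀ {u w} → Reach G S u w → Reach G S′ u w
  reach-mono S⊆S′ (stay su)     = stay (S⊆S′ su)
  reach-mono S⊆S′ (step su e r) = step (S⊆S′ su) e (reach-mono S⊆S′ r)

  -- The search deletes the start vertex before going on from a neighbor, so the fuel `f` bounds the
  -- size of what is left. By `reach-avoiding` no walk is missed.
  reach? : {S : VSet G} → Decidable S → ∀ u w → Dec (Reach G S u w)
  reach? S? = go _ S? ≤-refl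
    where
    go : ∀ f {S : VSet G} (S? : Decidable S) → size S? ≤ f → ∀ u w → Dec (Reach G S u w)
    go zero    S? |S|≤0 u w = no λ r → count-none S? (∈-allFin u) |S|≤0 (reach-start r)
    go (suc f) S? |S|≤1+f u w with S? u | w ≟ u
    ... | no ¬su | _        = no (¬su ∘ reach-start)
    ... | yes su | yes refl = yes (stay su)
    ... | yes su | no w≢u   = map′
      (λ (t , e , r) → step su e (reach-mono proj₁ r))
      -- The first alternative is impossible: it would be a walk that starts at `u` and avoids `u`.
      (λ r → [ (λ r′ → contradiction refl (proj₂ (reach-start r′))) , id ] (reach-avoiding u r w≢u))
      (any? λ t → adj? u t ×-dec
        go f (minus? S? u) (<⇒≤pred (<-≤-trans (size-minus S? su) |S|≤1+f)) t w)

  connected? : {S : VSet G} → Decidable S → Dec (Connected G S)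
  connected? S? = all? λ u → all? λ w → S? u →-dec (S? w →-dec reach? S? u w)

  -- Neighbor-depth

  nd-mono : ∀ {k l S} → k ≤ l → ND G k S → ND G l S
  nd-mono k≤l (empty S=∅)           = empty S=∅
  nd-mono k≤l (disconnected ¬c nds) = disconnected ¬c λ u su → nd-mono k≤l (nds u su)
  nd-mono (s≤s k≤l) (connected v c sv nd₁ nd₂) =
    connected v c sv (nd-mono k≤l nd₁) (nd-mono (s≤s k≤l) nd₂)

  -- Lets the later inductions assume connectivity, which the branching rule of `ND` demands,
  -- although deletions can disconnect the set.
  nd-by-components : ∀ {k} {S : VSet G} (S? : Decidable S) →
                     (∀ {C : VSet G} → Decidable C → (∀ {v} → C v → S v) →
                       Connected G C → ND G k C) →
                     ND G k S
  nd-by-components S? nd with connected? S?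
  ... | yes c = nd S? id c
  ... | no ¬c = disconnected ¬c λ u _ → nd (reach? S? u) reach-end (component-connected u)

  size≤1⇒≡ : {S : VSet G} (S? : Decidable S) → size S? ≤ 1 → ∀ {u w} → S u → S w → u ≡ w
  size≤1⇒≡ S? |S|≤1 {u} {w} su sw with u ≟ w
  ... | yes u≡w = u≡w
  ... | no u≢w  = contradiction |S|≤1 (<⇒≱ (begin-strict
    1                            <⟨ +-mono-≤ (size-nonempty (_≟ u) refl) (size-nonempty (_≟ w) refl) ⟩
    size (_≟ u) + size (_≟ w)    ≤⟨ count-disjoint (_≟ u) (_≟ w) S? (λ { refl → su }) (λ { refl → sw })
                                      (λ { refl → u≢w }) (allFin n) ⟩
    size S?                      ∎))

  nd-size≤1 : ∀ {k} {S : VSet G} (S? : Decidable S) → size S? ≤ 1 → ND G (suc k) S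
  nd-size≤1 {S = S} S? |S|≤1 with any? S?
  ... | no ¬∃      = empty λ v sv → ¬∃ (v , sv)
  -- Either deletion removes the only vertex, so both branches end in the empty set.
  ... | yes (v , sv) = connected v
    (λ u w su sw → subst (Reach G S u) (same su sw) (stay su)) sv
    (empty λ w (sw , w≢v , _) → w≢v (same sw sv))
    (empty λ w (sw , w≢v) → w≢v (same sw sv))
    where
    same : ∀ {u w} → S u → S w → u ≡ w
    same = size≤1⇒≡ S? |S|≤1

  -- Cuts

  pairs : List (Fin n × Fin n)
  pairs = cartesianProduct (allFin n) (allFin n)

  -- The closed neighborhood of `v`, which is exactly what `MinusN` deletes.
  Near : Fin n → Fin n → Set
  Near v w = w ≡ v ⊎ Adj G v w

  near? : ∀ v w → Dec (Near v w)
  near? v w = (w ≟ v) ⊎-dec adj? v w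

  -- These are the pairs that lose an endpoint when the closed neighborhood of `v` is deleted.
  Touches : Fin n → Fin n × Fin n → Set
  Touches v (x , y) = Near v x ⊎ Near v y

  touches? : ∀ v → Decidable (Touches v)
  touches? v (x , y) = near? v x ⊎-dec near? v y

  module Cut {A : VSet G} (A? : Decidable A) where

    CutEdge : VSet G → Fin n × Fin n → Set
    CutEdge S (x , y) = S x × S y × A x × ¬ A y × Adj G x y

    cutEdge? : {S : VSet G} → Decidable S → Decidable (CutEdge S)
    cutEdge? S? (x , y) = S? x ×-dec (S? y ×-dec (A? x ×-dec (¬? (A? y) ×-dec adj? x y)))

    cutSize : {S : VSet G} → Decidable S → ℕ
    cutSize S? = count (cutEdge? S?) pairs

    cutEdge-mono : ∀ {S S′ : VSet G} → (∀ {v} → S v → S′ v) → ∀ {e} → CutEdge S e → CutEdge S′ e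
    cutEdge-mono S⊆S′ (sx , sy , rest) = S⊆S′ sx , S⊆S′ sy , rest

    inside? : {S : VSet G} → Decidable S → Decidable (λ v → S v × A v)
    inside? S? v = S? v ×-dec A? v

    outside? : {S : VSet G} → Decidable S → Decidable (λ v → S v × ¬ A v)
    outside? S? v = S? v ×-dec ¬? (A? v)

    reach-crossing : ∀ {S : VSet G} {u w} → Reach G S u w → A u → ¬ A w → ∃ (CutEdge S)
    reach-crossing (stay _) au ¬aw = contradiction au ¬aw
    reach-crossing (step {u} {t} su e r) au ¬aw with A? t
    ... | yes at = reach-crossing r at ¬aw
    ... | no ¬at = (u , t) , su , reach-start r , au , ¬at , e

    -- Induced matchings across the cut

    open InducedMatchingAcross

    empty-matching : InducedMatchingAcross G A 0
    empty-matching = record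
      { a = []ᶠ ; b = []ᶠ ; a∈A = λ () ; b∉A = λ () ; edge = λ ()
      ; a-inj = λ () ; b-inj = λ () ; no-aa = λ () ; no-ab = λ () ; no-bb = λ () }

    -- Being untouched excludes equality as well as adjacency, so the two hypotheses on `x` and `y`
    -- yield both injectivity and inducedness of the larger matching.
    extend-matching : ∀ {m} (M : InducedMatchingAcross G A m) {x y} →
                      A x → ¬ A y → Adj G x y →
                      (∀ i → ¬ Touches x (a M i , b M i)) →
                      (∀ i → ¬ Touches y (a M i , b M i)) →
                      InducedMatchingAcross G A (suc m)
    extend-matching M {x} {y} ax ¬ay xy ¬tx ¬ty = record
      { a     = x ∷ᶠ a M
      ; b     = y ∷ᶠ b M
      ; a∈A   = λ { zero → ax ; (suc i) → a∈A M i }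
      ; b∉A   = λ { zero → ¬ay ; (suc i) → b∉A M i }
      ; edge  = λ { zero → xy ; (suc i) → edge M i }
      ; a-inj = λ { zero zero _ → refl
                  ; zero (suc j) x≡a → contradiction (inj₁ (inj₁ (sym x≡a))) (¬tx j)
                  ; (suc i) zero a≡x → contradiction (inj₁ (inj₁ a≡x)) (¬tx i)
                  ; (suc i) (suc j) a≡a → cong suc (a-inj M i j a≡a) }
      ; b-inj = λ { zero zero _ → refl
                  ; zero (suc j) y≡b → contradiction (inj₂ (inj₁ (sym y≡b))) (¬ty j)
                  ; (suc i) zero b≡y → contradiction (inj₂ (inj₁ b≡y)) (¬ty i)
                  ; (suc i) (suc j) b≡b → cong suc (b-inj M i j b≡b) }
      ; no-aa = λ { zero zero 0≢0 _ → 0≢0 refl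
                  ; zero (suc j) _ e → ¬tx j (inj₁ (inj₂ e))
                  ; (suc i) zero _ e → ¬tx i (inj₁ (inj₂ (Adj-sym e)))
                  ; (suc i) (suc j) i≢j → no-aa M i j (i≢j ∘ cong suc) }
      ; no-ab = λ { zero zero 0≢0 _ → 0≢0 refl
                  ; zero (suc j) _ e → ¬tx j (inj₂ (inj₂ e))
                  ; (suc i) zero _ e → ¬ty i (inj₁ (inj₂ (Adj-sym e)))
                  ; (suc i) (suc j) i≢j → no-ab M i j (i≢j ∘ cong suc) }
      ; no-bb = λ { zero zero 0≢0 _ → 0≢0 refl
                  ; zero (suc j) _ e → ¬ty j (inj₂ (inj₂ e))
                  ; (suc i) zero _ e → ¬ty i (inj₂ (inj₂ (Adj-sym e)))
                  ; (suc i) (suc j) i≢j → no-bb M i j (i≢j ∘ cong suc) }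
      }

    -- Greedy matchings and heavy vertices

    Touched : (Fin n × Fin n → Set) → Fin n → Fin n × Fin n → Set
    Touched X v e = X e × Touches v e

    touched? : ∀ {X} → Decidable X → ∀ v → Decidable (Touched X v)
    touched? X? v e = X? e ×-dec touches? v e

    Untouched : (Fin n × Fin n → Set) → Fin n × Fin n → Fin n × Fin n → Set
    Untouched X (x , y) e = X e × ¬ Touches x e × ¬ Touches y e

    untouched? : ∀ {X} → Decidable X → ∀ e → Decidable (Untouched X e)
    untouched? X? (x , y) e = X? e ×-dec (¬? (touches? x e) ×-dec ¬? (touches? y e))

    count-untouched : ∀ {X} (X? : Decidable X) {x y t} →
                      count (touched? X? x) pairs ≤ t → count (touched? X? y) pairs ≤ t →
                      count X? pairs ≤ t + t + count (untouched? X? (x , y)) pairs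
    count-untouched {X} X? {x} {y} {t} tx≤t ty≤t = begin
      count X? pairs
        ≤⟨ count-cover tx? ty∪u? X? split₁ pairs ⟩
      count tx? pairs + count ty∪u? pairs
        ≤⟨ +-monoʳ-≤ (count tx? pairs) (count-cover ty? u? ty∪u? id pairs) ⟩
      count tx? pairs + (count ty? pairs + count u? pairs)
        ≤⟨ +-mono-≤ tx≤t (+-monoˡ-≤ (count u? pairs) ty≤t) ⟩
      t + (t + count u? pairs)
        ≡⟨ +-assoc t t _ ⟨
      t + t + count u? pairs ∎
      where
      tx? = touched? X? x
      ty? = touched? X? y
      u?  = untouched? X? (x , y)
      ty∪u? : Decidable (λ e → Touched X y e ⊎ Untouched X (x , y) e)
      ty∪u? e = ty? e ⊎-dec u? e
      split₁ : ∀ {e} → X e → Touched X x e ⊎ (Touched X y e ⊎ Untouched X (x , y) e)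
      split₁ {e} xe with touches? x e | touches? y e
      ... | yes tx | _      = inj₁ (xe , tx)
      ... | no ¬tx | yes ty = inj₂ (inj₁ (xe , ty))
      ... | no ¬tx | no ¬ty = inj₂ (inj₂ (xe , ¬tx , ¬ty))

    MatchingIn : (Fin n × Fin n → Set) → ℕ → Set
    MatchingIn X m = Σ (InducedMatchingAcross G A m) λ M → ∀ i → X (a M i , b M i)

    extend-matchingIn : ∀ {S X m} → (∀ {e} → X e → CutEdge S e) → ∀ {e} → X e →
                        MatchingIn (Untouched X e) m → MatchingIn X (suc m)
    extend-matchingIn X⊆cut {x , y} xe (M , M⊆U) with X⊆cut xe
    ... | _ , _ , ax , ¬ay , xy =
      extend-matching M ax ¬ay xy (proj₁ ∘ proj₂ ∘ M⊆U) (proj₂ ∘ proj₂ ∘ M⊆U) ,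
      λ { zero → xe ; (suc i) → proj₁ (M⊆U i) }

    -- Greedy choice of a matching: each chosen edge rules out at most 2t
    -- others as long as no vertex touches more than t of them.
    heavy-or-matching : ∀ {S : VSet G} t m {X} (X? : Decidable X) →
                        (∀ {e} → X e → CutEdge S e) →
                        m * (t + t) < count X? pairs →
                        (∃[ v ] (S v × t < count (touched? X? v) pairs)) ⊎ MatchingIn X (suc m)
    heavy-or-matching t zero X? X⊆cut 0<|X| with count-witness X? pairs 0<|X|
    ... | _ , xe = inj₂ (extend-matchingIn X⊆cut xe (empty-matching , λ ()))
    heavy-or-matching t (suc m) X? X⊆cut m[t+t]<|X|
      with (x , y) , xe ← count-witness X? pairs (≤-<-trans z≤n m[t+t]<|X|)
      with count (touched? X? x) pairs ≤? t | count (touched? X? y) pairs ≤? t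
    ... | no t≱x  | _       = inj₁ (x , proj₁ (X⊆cut xe) , ≰⇒> t≱x)
    ... | yes _   | no t≱y  = inj₁ (y , proj₁ (proj₂ (X⊆cut xe)) , ≰⇒> t≱y)
    ... | yes x≤t | yes y≤t
      with heavy-or-matching t m (untouched? X? (x , y)) (X⊆cut ∘ proj₁)
             -- Discarding the edges touched by `x` or `y` costs at most `t + t`, so more than
             -- `m * (t + t)` edges survive for the remaining `m + 1` matching edges.
             (+-cancelˡ-< (t + t) _ _ (<-≤-trans m[t+t]<|X| (count-untouched X? x≤t y≤t)))
    ...   | inj₂ M = inj₂ (extend-matchingIn X⊆cut xe M)
    ...   | inj₁ (v , sv , t<v) = inj₁ (v , sv ,
              <-≤-trans t<v (count-mono (touched? (untouched? X? (x , y)) v) (touched? X? v)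
                               (λ ((xe , _) , tv) → xe , tv) pairs))

    -- The greedy search cannot return `k + 1` matching edges, because the width is at most `k`; so
    -- it must run into a vertex touching more than `t` cut edges, for every `t` with `k * (t + t)`
    -- below the number of cut edges.
    heavy-vertex : ∀ {k} → 1 ≤ k → SwLE G A k → {S : VSet G} (S? : Decidable S) → 0 < cutSize S? →
                   ∃[ v ] (S v × cutSize S? ≤ (k + k) * count (touched? (cutEdge? S?) v) pairs)
    heavy-vertex {k@(suc _)} _ sw {S} S? 0<|E| =
      heavy (heavy-or-matching (c / r) k (cutEdge? S?) id k[t+t]<|E|)
      where
      r c : ℕ
      r = k + k
      -- Taking the predecessor makes `t = c / r` the largest value with `t * r` strictly below the
      -- cut size; then `suc t * r` is at least the cut size.
      c = pred (cutSize S?)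
      h : Fin n → ℕ
      h v = count (touched? (cutEdge? S?) v) pairs
      1+c≡|E| : suc c ≡ cutSize S?
      1+c≡|E| = suc-pred (cutSize S?) {{>-nonZero 0<|E|}}
      eq : ∀ k t → k * (t + t) ≡ t * (k + k)
      eq = solve-∀
      k[t+t]<|E| : k * (c / r + c / r) < cutSize S?
      k[t+t]<|E| = begin-strict
        k * (c / r + c / r)   ≡⟨ eq k (c / r) ⟩
        c / r * r             ≤⟨ m/n*n≤m c r ⟩
        c                     <⟨ n<1+n c ⟩
        suc c                 ≡⟨ 1+c≡|E| ⟩
        cutSize S?            ∎
      heavy : (∃[ v ] (S v × c / r < h v)) ⊎ MatchingIn (CutEdge S) (suc k) →
              ∃[ v ] (S v × cutSize S? ≤ r * h v)
      heavy (inj₂ (M , _))        = contradiction (sw (suc k) M) (<⇒≱ (n<1+n k))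
      heavy (inj₁ (v , sv , t<h)) = v , sv , (begin
        cutSize S?                 ≡⟨ 1+c≡|E| ⟨
        suc c                      ≡⟨ cong suc (m≡m%n+[m/n]*n c r) ⟩
        suc (c % r) + c / r * r    ≤⟨ +-monoˡ-≤ (c / r * r) (m%n<n c r) ⟩
        suc (c / r) * r            ≤⟨ *-monoˡ-≤ r t<h ⟩
        h v * r                    ≡⟨ *-comm (h v) r ⟩
        r * h v                    ∎)

    -- A touched edge has an endpoint in the deleted neighborhood, so no touched edge is among the
    -- surviving ones.
    cutSize-minusN : {S : VSet G} (S? : Decidable S) → ∀ v →
                     count (touched? (cutEdge? S?) v) pairs + cutSize (minusN? S? v) ≤ cutSize S?
    cutSize-minusN {S} S? v = count-disjoint (touched? (cutEdge? S?) v) (cutEdge? (minusN? S? v)) (cutEdge? S?)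
      proj₁ (cutEdge-mono {MinusN G S v} {S} proj₁)
      (λ { (_ , inj₁ (inj₁ x≡v)) ((_ , x≢v , _) , _) → x≢v x≡v
         ; (_ , inj₁ (inj₂ vx)) ((_ , _ , ¬vx) , _) → ¬vx vx
         ; (_ , inj₂ (inj₁ y≡v)) (_ , (_ , y≢v , _) , _) → y≢v y≡v
         ; (_ , inj₂ (inj₂ vy)) (_ , (_ , _ , ¬vy) , _) → ¬vy vy })
      pairs

    -- A walk from one side to the other would contain a cut edge, so a connected set without cut
    -- edges lies entirely on one side.
    one-sided : {S : VSet G} (S? : Decidable S) → Connected G S → cutSize S? ≤ 0 →
                size S? ≤ size (inside? S?) ⊎ size S? ≤ size (outside? S?)
    one-sided {S} S? conn |E|≤0 with any? (inside? S?)
    ... | yes (u , su , au) = inj₁ (count-mono S? (inside? S?) all-inside (allFin n))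
      where
      all-inside : ∀ {w} → S w → S w × A w
      all-inside {w} sw with A? w
      ... | yes aw = sw , aw
      ... | no ¬aw with reach-crossing (conn u w su sw) au ¬aw
      ...   | (x , y) , e = contradiction e
                (count-none (cutEdge? S?) (∈-cartesianProduct⁺ (∈-allFin x) (∈-allFin y)) |E|≤0)
    ... | no ∄inside = inj₂ (count-mono S? (outside? S?) (λ {v} sv → sv , λ av → ∄inside (v , sv , av)) (allFin n))

    -- Eliminating the edges of one cut

    module _ {k s d : ℕ} (1≤k : 1 ≤ k) (sw : SwLE G A k)
             (nd-small : ∀ {S : VSet G} (S? : Decidable S) → 3 * size S? ≤ s → ND G (suc d) S)
             where

      private
        r : ℕ
        r = k + k

      -- After the removal of at most q well-chosen closed neighborhoods no cut edge
      -- remains: each removal scales the cut size by at most r / (1 + r).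
      Separable : ℕ → {S : VSet G} → Decidable S → Set
      Separable q S? = 3 * size (inside? S?) ≤ s × 3 * size (outside? S?) ≤ s ×
                       cutSize S? * r ^ q < suc r ^ q

      separable-mono : ∀ q {S C : VSet G} (C? : Decidable C) (S? : Decidable S) →
                       (∀ {v} → C v → S v) → Separable q S? → Separable q C?
      separable-mono q {S} {C} C? S? C⊆S (in≤s , out≤s , few) =
        ≤-trans (*-monoʳ-≤ 3 (count-mono (inside? C?) (inside? S?) (λ (cv , av) → C⊆S cv , av) (allFin n))) in≤s ,
        ≤-trans (*-monoʳ-≤ 3 (count-mono (outside? C?) (outside? S?) (λ (cv , av) → C⊆S cv , av) (allFin n))) out≤s ,
        ≤-<-trans (*-monoˡ-≤ (r ^ q) (count-mono (cutEdge? C?) (cutEdge? S?) (cutEdge-mono {C} {S} C⊆S) pairs)) few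

      -- With `h ≥ E / r` edges destroyed, at most `E * (r - 1) / r` survive; the slightly weaker
      -- factor `r / (1 + r)` keeps the arithmetic free of subtraction.
      separable-minusN : ∀ q {S : VSet G} (S? : Decidable S) v →
                         cutSize S? ≤ r * count (touched? (cutEdge? S?) v) pairs →
                         Separable (suc q) S? → Separable q (minusN? S? v)
      separable-minusN q S? v E≤rh sep@(_ , _ , few) =
        let in≤s , out≤s , _ = separable-mono (suc q) (minusN? S? v) S? proj₁ sep in
        in≤s , out≤s , *-cancelˡ-< (suc r) _ _ (begin-strict
          suc r * (E′ * r ^ q)         ≡⟨ *-assoc (suc r) E′ (r ^ q) ⟨
          suc r * E′ * r ^ q           ≤⟨ *-monoˡ-≤ (r ^ q) [1+r]E′≤rE ⟩
          r * E * r ^ q                ≡⟨ eq r E (r ^ q) ⟩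
          E * (r * r ^ q)              <⟨ few ⟩
          suc r * suc r ^ q            ∎)
        where
        E E′ h : ℕ
        E  = cutSize S?
        E′ = cutSize (minusN? S? v)
        h  = count (touched? (cutEdge? S?) v) pairs
        eq : ∀ x y z → x * y * z ≡ y * (x * z)
        eq = solve-∀
        E′≤E : E′ ≤ E
        E′≤E = m+n≤o⇒n≤o h (cutSize-minusN S? v)
        [1+r]E′≤rE : suc r * E′ ≤ r * E
        [1+r]E′≤rE = begin
          E′ + r * E′       ≤⟨ +-monoˡ-≤ (r * E′) (≤-trans E′≤E E≤rh) ⟩
          r * h + r * E′    ≡⟨ *-distribˡ-+ r h E′ ⟨
          r * (h + E′)      ≤⟨ *-monoʳ-≤ r (cutSize-minusN S? v) ⟩
          r * E             ∎

      nd-cut-free : ∀ q {S : VSet G} (S? : Decidable S) → Separable q S? → Connected G S →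
                    cutSize S? ≤ 0 → ND G (suc (q + d)) S
      nd-cut-free q S? (in≤s , out≤s , _) conn E≤0 =
        nd-mono (s≤s (m≤n+m d q)) (nd-small S? ([ bound in≤s , bound out≤s ] (one-sided S? conn E≤0)))
        where
        bound : ∀ {m} → 3 * m ≤ s → size S? ≤ m → 3 * size S? ≤ s
        bound 3m≤s |S|≤m = ≤-trans (*-monoʳ-≤ 3 |S|≤m) 3m≤s

      cut-free-or-heavy : {S : VSet G} (S? : Decidable S) → cutSize S? ≤ 0 ⊎
                          (∃[ v ] (S v × cutSize S? ≤ r * count (touched? (cutEdge? S?) v) pairs))
      cut-free-or-heavy S? with cutSize S? ≤? 0
      ... | yes E≤0 = inj₁ E≤0
      ... | no E≰0  = inj₂ (heavy-vertex 1≤k sw S? (≰⇒> E≰0))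

      -- Lexicographic induction on the budget `q` of neighborhood removals and a size bound `f`.
      -- Removing a closed neighborhood lowers `q` and resets `f`; deleting only the vertex keeps
      -- `q` and lowers `f`. Separability passes to subsets, hence to components.
      nd-separable : ∀ q {S : VSet G} (S? : Decidable S) → Separable q S? → ND G (suc (q + d)) S
      nd-separable q S? = go q _ S? ≤-refl
        where
        go : ∀ q f {S : VSet G} (S? : Decidable S) → size S? ≤ f → Separable q S? → ND G (suc (q + d)) S
        go-connected : ∀ q f {S : VSet G} (S? : Decidable S) → size S? ≤ f → Separable q S? →
                       Connected G S → ND G (suc (q + d)) S

        go q f S? |S|≤f sep = nd-by-components S? λ C? C⊆S →
          go-connected q f C? (≤-trans (count-mono C? S? C⊆S (allFin n)) |S|≤f)
            (separable-mono q C? S? C⊆S sep)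

        go-connected q zero S? |S|≤0 _ _ = empty λ v → count-none S? (∈-allFin v) |S|≤0
        -- For `q = 0` the hypothesis `few` reads `cutSize S? * 1 < 1`, so no cut edge is left.
        go-connected zero (suc f) S? _ sep@(_ , _ , few) conn =
          nd-cut-free 0 S? sep conn (≤-trans (≤-reflexive (sym (*-identityʳ _))) (<⇒≤pred few))
        go-connected (suc q) (suc f) S? |S|≤1+f sep conn =
          [ nd-cut-free (suc q) S? sep conn
          , (λ (v , sv , E≤rh) → connected v conn sv
              (go q _ (minusN? S? v) ≤-refl (separable-minusN q S? v E≤rh sep))
              (go (suc q) f (minus? S? v) (<⇒≤pred (<-≤-trans (size-minus S? sv) |S|≤1+f))
                (separable-mono (suc q) (minus? S? v) S? proj₁ sep)))
          ] (cut-free-or-heavy S?)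

  -- Balanced cuts of a branch decomposition

  module _ {S : VSet G} (S? : Decidable S) where

    open DecMembership (_≟_ {n}) using (_∈?_)

    weight : BTree G → ℕ
    weight t = size (λ v → S? v ×-dec (v ∈? leaves G t))

    weight-leaf : ∀ v → weight (leaf v) ≤ 1
    weight-leaf v = ≤-trans
      (count-mono (λ w → S? w ×-dec (w ∈? leaves G (leaf v))) (_≟ v) (λ { (_ , here refl) → refl }) (allFin n))
      (singleton (filter (_≟ v) (allFin n)) (filter⁺ (_≟ v) (allFin⁺ n)) (proj₂ ∘ ∈-filter⁻ (_≟ v) {xs = allFin n}))
      where
      singleton : ∀ (xs : List (Fin n)) → Unique xs → (∀ {x} → x ∈ xs → x ≡ v) → length xs ≤ 1
      singleton []           _ _ = z≤n
      singleton (x ∷ [])     _ _ = ≤-refl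
      singleton (x ∷ y ∷ xs) ((x≢y ∷ _) ∷ _) ≡v =
        contradiction (trans (≡v (here refl)) (sym (≡v (there (here refl))))) x≢y

    weight-node : ∀ l r → weight (node l r) ≤ weight l + weight r
    weight-node l r = count-cover
      (λ v → S? v ×-dec (v ∈? leaves G l)) (λ v → S? v ×-dec (v ∈? leaves G r))
      (λ v → S? v ×-dec (v ∈? leaves G (node l r)))
      (λ (sv , v∈) → [ (λ v∈l → inj₁ (sv , v∈l)) , (λ v∈r → inj₂ (sv , v∈r)) ] (∈-++⁻ (leaves G l) v∈))
      (allFin n)

    -- Descend into a child as long as one still carries more than 2/3 of `S`. Where the descent
    -- stops, the children together carry more than 2/3, so one of them carries at least 1/3 and at
    -- most 2/3.
    balanced-subtree : ∀ {k} → 2 ≤ size S? → ∀ t → WidthLE G t k → 2 * size S? < 3 * weight t →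
                       ∃[ u ] (SwLE G (_∈ leaves G u) k ×
                               size S? ≤ 3 * weight u × 3 * weight u ≤ 2 * size S?)
    -- The descent never reaches a leaf: there `3 * weight` is at most 3, while `2 * size S?` is at
    -- least 4.
    balanced-subtree 2≤|S| (leaf v) width 2|S|<3w = contradiction (≤-trans 2|S|<3w (*-monoʳ-≤ 3 (weight-leaf v)))
      (<⇒≱ (s≤s (≤-trans (n≤1+n 3) (*-monoʳ-≤ 2 2≤|S|))))
    balanced-subtree 2≤|S| (node l r) width 2|S|<3w
      with 3 * weight l ≤? 2 * size S? | 3 * weight r ≤? 2 * size S?
    ... | no l≰   | _       = balanced-subtree 2≤|S| l (λ s s⊑l → width s (left s⊑l)) (≰⇒> l≰)
    ... | yes _   | no r≰   = balanced-subtree 2≤|S| r (λ s s⊑r → width s (right s⊑r)) (≰⇒> r≰)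
    ... | yes l≤  | yes r≤  with size S? ≤? 3 * weight l | size S? ≤? 3 * weight r
    ...   | yes ≤l | _      = l , width l (left here) , ≤l , l≤
    ...   | no _   | yes ≤r = r , width r (right here) , ≤r , r≤
    ...   | no ≰l  | no ≰r  = contradiction 2|S|<3w (≤⇒≯ (begin
      3 * weight (node l r)            ≤⟨ *-monoʳ-≤ 3 (weight-node l r) ⟩
      3 * (weight l + weight r)        ≡⟨ *-distribˡ-+ 3 (weight l) (weight r) ⟩
      3 * weight l + 3 * weight r      ≤⟨ +-mono-≤ (≰⇒≥ ≰l) (≰⇒≥ ≰r) ⟩
      size S? + size S?                ≡⟨ cong (size S? +_) (+-identityʳ _) ⟨
      2 * size S?                      ∎))

  -- Recursion over balanced cuts

  module _ {k l : ℕ} (1≤k : 1 ≤ k) (n≤2^l : n ≤ 2 ^ l) {t : BTree G}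
           (covering : ∀ v → v ∈ leaves G t) (width : WidthLE G t k) where

    open DecMembership (_≟_ {n}) using (_∈?_)

    private
      r q : ℕ
      r = k + k
      -- Every `r` removals halve the bound on the cut size, which starts at `n * n ≤ 2 ^ (l + l)`;
      -- one halving beyond `l + l` pushes it strictly below 1.
      q = r * suc (l + l)

    n²r^q<[1+r]^q : ∀ {m} → m ≤ n * n → m * r ^ q < suc r ^ q
    n²r^q<[1+r]^q {m} m≤n² = begin-strict
      m * r ^ q                    ≤⟨ *-monoˡ-≤ (r ^ q) (≤-trans m≤n² (*-mono-≤ n≤2^l n≤2^l)) ⟩
      2 ^ l * 2 ^ l * r ^ q        ≡⟨ cong (_* r ^ q) (^-distribˡ-+-* 2 l l) ⟨
      2 ^ (l + l) * r ^ q          <⟨ *-monoˡ-< (r ^ q) {{m^n≢0 r q}} (^-monoʳ-< 2 ≤-refl (n<1+n (l + l))) ⟩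
      2 ^ suc (l + l) * r ^ q      ≤⟨ 2^j*r^[r*j]≤[1+r]^[r*j] r (suc (l + l)) ⟩
      suc r ^ q                    ∎
      where instance
        r≢0 : NonZero r
        r≢0 = >-nonZero (≤-trans 1≤k (m≤m+n k k))

    2|S|<3w : {S : VSet G} (S? : Decidable S) → 2 ≤ size S? → 2 * size S? < 3 * weight S? t
    2|S|<3w S? 2≤|S| = <-≤-trans
      (*-monoˡ-< (size S?) {{>-nonZero (≤-trans (n≤1+n 1) 2≤|S|)}} (n<1+n 2))
      (*-monoʳ-≤ 3 (count-mono S? (λ v → S? v ×-dec (v ∈? leaves G t))
                     (λ {v} sv → sv , covering v) (allFin n)))

    -- The hypothesis bounds the size by `(3/2)^p`. Both sides of a balanced cut of `S` have at most
    -- 2/3 of its size and so fall under the bound for `p - 1`; eliminating the cut edges adds `q`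
    -- to the depth.
    nd-by-halving : ∀ p {S : VSet G} (S? : Decidable S) → size S? * 2 ^ p ≤ 3 ^ p → ND G (suc (p * q)) S
    nd-by-halving zero    S? |S|≤1 = nd-size≤1 S? (≤-trans (≤-reflexive (sym (*-identityʳ _))) |S|≤1)
    nd-by-halving (suc p) {S} S? |S|2^p≤3^p with 2 ≤? size S?
    ... | no 2≰|S| = nd-size≤1 S? (<⇒≤pred (≰⇒> 2≰|S|))
    ... | yes 2≤|S|
      with u , sw , |S|≤3w , 3w≤2|S| ← balanced-subtree S? 2≤|S| t width (2|S|<3w S? 2≤|S|) =
      nd-separable (_∈? leaves G u) 1≤k sw nd-small q S?
        -- Here `s` is `2 * size S?`, so small means at most 2/3 of the current set.
        (3w≤2|S| , out≤ , n²r^q<[1+r]^q cutSize≤n²)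
      where
      open Cut
      nd-small : ∀ {C : VSet G} (C? : Decidable C) → 3 * size C? ≤ 2 * size S? → ND G (suc (p * q)) C
      nd-small C? 3|C|≤2|S| = nd-by-halving p C? (*-cancelˡ-≤ 3 (begin
        3 * (size C? * 2 ^ p)    ≡⟨ *-assoc 3 (size C?) (2 ^ p) ⟨
        3 * size C? * 2 ^ p      ≤⟨ *-monoˡ-≤ (2 ^ p) 3|C|≤2|S| ⟩
        2 * size S? * 2 ^ p      ≡⟨ eq (size S?) (2 ^ p) ⟩
        size S? * (2 * 2 ^ p)    ≤⟨ |S|2^p≤3^p ⟩
        3 * 3 ^ p                ∎))
        where
        eq : ∀ x y → 2 * x * y ≡ x * (2 * y)
        eq = solve-∀
      out : ℕ
      out = size (outside? (_∈? leaves G u) S?)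
      out≤ : 3 * out ≤ 2 * size S?
      out≤ = +-cancelˡ-≤ (size S?) _ _ (begin
        size S? + 3 * out              ≤⟨ +-monoˡ-≤ (3 * out) |S|≤3w ⟩
        3 * weight S? u + 3 * out      ≡⟨ *-distribˡ-+ 3 (weight S? u) out ⟨
        3 * (weight S? u + out)        ≤⟨ *-monoʳ-≤ 3 (count-disjoint
                                            (inside? (_∈? leaves G u) S?) (outside? (_∈? leaves G u) S?) S?
                                            proj₁ proj₁ (λ (_ , v∈u) (_ , v∉u) → v∉u v∈u) (allFin n)) ⟩
        3 * size S?                    ∎)
      cutSize≤n² : cutSize (_∈? leaves G u) S? ≤ n * n
      cutSize≤n² = begin
        cutSize (_∈? leaves G u) S?              ≤⟨ length-filter (cutEdge? (_∈? leaves G u) S?) pairs ⟩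
        length pairs                             ≡⟨ length-cartesianProduct (allFin n) (allFin n) ⟩
        length (allFin n) * length (allFin n)    ≡⟨ cong₂ _*_ |V|≡n |V|≡n ⟩
        n * n                                    ∎
        where
        |V|≡n : length (allFin n) ≡ n
        |V|≡n = length-tabulate id

    nd-whole : ND G (suc (2 * l * q)) (λ _ → ⊤)
    nd-whole = nd-by-halving (2 * l) ⊤? (≤-trans
      (*-monoˡ-≤ (2 ^ (2 * l)) (≤-trans (length-filter ⊤? (allFin n)) (≤-reflexive (length-tabulate {n = n} id))))
      (n*4^l≤9^l l n≤2^l))
      where
      ⊤? : Decidable (λ (_ : Fin n) → ⊤)
      ⊤? _ = yes tt

-- The final bound

depth-bound : ∀ {k l} → 1 ≤ k → 1 ≤ l → suc (2 * l * ((k + k) * suc (l + l))) ≤ 13 * k * (l * l)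
depth-bound {k} {l} 1≤k 1≤l = begin
  suc (2 * l * ((k + k) * suc (l + l)))
    -- The constant is 12 + 1: from `1 ≤ l`, the product is at most `2l * 2k * 3l`, and the leading
    -- successor is absorbed by one more `k * (l * l)`.
    ≤⟨ +-mono-≤ 1≤kll (*-monoʳ-≤ (2 * l) (*-monoʳ-≤ (k + k) (+-monoˡ-≤ (l + l) 1≤l))) ⟩
  k * (l * l) + 2 * l * ((k + k) * (l + (l + l)))
    ≡⟨ eq k l ⟩
  13 * k * (l * l) ∎
  where
  1≤kll : 1 ≤ k * (l * l)
  1≤kll = *-mono-≤ 1≤k (*-mono-≤ 1≤l 1≤l)
  eq : ∀ k l → k * (l * l) + 2 * l * ((k + k) * (l + (l + l))) ≡ 13 * k * (l * l)
  eq = solve-∀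

theorem4 : ∃[ c ] (∀ n → 2 ≤ n → (G : Graph n) → ∀ k → 1 ≤ k → SimWidth G k →
    NeighborDepthLE G (c * k * (⌈log₂ n ⌉ * ⌈log₂ n ⌉)))
theorem4 = 13 , λ n 2≤n G k 1≤k ((T , (_ , covering) , width) , _) →
  -- From `2 ≤ n` the logarithm is at least that of 2, which is 1.
  nd-mono G (depth-bound 1≤k (⌈log₂⌉-mono-≤ 2≤n))
    (nd-whole G {l = ⌈log₂ n ⌉} 1≤k (n≤2^⌈log₂n⌉ n) covering width)
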